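{- It holds that $\mathcal{M}\equiv\mathcal{C}\mathcal{C}^{T}$, i.e. the two matrices are equal entrywise over $\mathbb{Z}_2$ (modulo $2$).
   Context: Let $U=[t]=\{1,\dots,t\}$ with $t\ge 1$, and let $\Pi(U)$ be the set of all partitions of $U$. Write $p\sqsubseteq q$ if $p$ is coarser than (or equal to) $q$, i.e. every block of $q$ is contained in a block of $p$. This makes $\Pi(U)$ a lattice with minimum $\{U\}$ and maximum the partition into singletons; $\sqcap$ denotes its meet, i.e. $p\sqcap q$ is the finest partition coarser than both $p$ and $q$. Define $\mathcal{M}\in\mathbb{Z}_2^{\Pi(U)\times\Pi(U)}$ by $\mathcal{M}[p,q]=1$ if $p\sqcap q=\{U\}$ and $\mathcal{M}[p,q]=0$ otherwise. Let $\mathrm{cuts}(t)=\{(V_1,V_2)\mid V_1\cup V_2=U,\ V_1\cap V_2=\emptyset,\ 1\in V_1\}$, where $1$ is a fixed element of $U$ and $V_2$ may be empty. A cut $(V_1,V_2)$ is identified with the partition of $U$ whose blocks are the nonempty sets among $V_1,V_2$; thus $(V_1,V_2)\sqsubseteq p$ means that every block of $p$ is contained in $V_1$ or in $V_2$. Define $\mathcal{C}\in\mathbb{Z}_2^{\Pi(U)\times\mathrm{cuts}(t)}$ by $\mathcal{C}[p,(V_1,V_2)]=1$ if $(V_1,V_2)\sqsubseteq p$ and $0$ otherwise. -}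

module Defs where

open import Data.Bool.Base using (Bool; true; false; T; if_then_else_)
open import Data.Bool.Properties using (T?)
open import Data.Fin.Base using (Fin; zero; suc)
open import Data.Fin.Subset
open import Data.Fin.Subset.Properties
open import Data.List.Base using (List; []; _∷_; _++_; map; foldr)
open import Data.List.Membership.Propositional using () renaming (_∈_ to _∈ₗ_)
open import Data.List.Membership.Propositional.Properties using (∈-map⁺; ∈-map⁻; ∈-++⁺ˡ; ∈-++⁺ʳ)
open import Data.List.Relation.Unary.All as All using ()
open import Data.List.Relation.Unary.AllPairs.Core as AllPairs using ()
open import Data.List.Relation.Unary.Any using (here)
open import Data.List.Relation.Unary.Unique.Propositional using (Unique)
open import Data.List.Relation.Unary.Unique.Propositional.Properties as Unique using ()
open import Data.Nat.Base using (ℕ; zero; suc)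
open import Data.Parity.Base using (Parity; 0ℙ; 1ℙ) renaming (_+_ to _⊕_; _*_ to _⊗_)
open import Data.Product.Base using (∃; _×_; _,_; proj₁; proj₂)
open import Data.Sum.Base using (_⊎_; inj₁; inj₂)
import Data.Vec.Base as Vec
import Data.Vec.Properties as Vec
import Data.Bool.Properties as Bool
open import Function.Base using (_∘_)
open import Relation.Binary.Lattice.Definitions using (Infimum)
open import Relation.Binary.Structures using (IsPartialOrder)
open import Relation.Binary.PropositionalEquality.Core using (_≡_; refl; sym; trans; cong; subst)
open import Relation.Nullary using (Dec; yes; no; ¬_; contradiction)
open import Relation.Nullary.Decidable
  using (⌊_⌋; toWitness; fromWitness; ¬?; _×-dec_; _⊎-dec_; _→-dec_; map′; decidable-stable; recompute)

private variable
  t n : ℕ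

_≟ₛ_ : (B C : Subset t) → Dec (B ≡ C)
_≟ₛ_ = Vec.≡-dec Bool._≟_

allSubset? : {P : Subset t → Set} → (∀ B → Dec (P B)) → Dec (∀ B → P B)
allSubset? P? = map′
  (λ ¬∃ B → decidable-stable (P? B) (λ ¬PB → ¬∃ (B , ¬PB)))
  (λ ∀P (B , ¬PB) → ¬PB (∀P B))
  (¬? (anySubset? (λ B → ¬? (P? B))))

------------------------------------------------------------------------
-- Partitions of Fin t

-- The set of blocks, a set of subsets of Fin t, is given by its
-- characteristic function.
record Partition (t : ℕ) : Set where
  field
    isBlock : Subset t → Bool

  Block : Subset t → Set
  Block B = T (isBlock B)

  field
    nonempty : ∀ {B} → Block B → Nonempty B
    covers   : ∀ x → ∃ λ B → Block B × x ∈ B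
    disjoint : ∀ {B C x} → Block B → Block C → x ∈ B → x ∈ C → B ≡ C

  Block? : ∀ B → Dec (Block B)
  Block? B = T? (isBlock B)

open Partition

infix 4 _≈_ _⊑_ _≈?_ _⊑?_

-- Having the same blocks; propositional equality would also compare the
-- proof components.
_≈_ : Partition t → Partition t → Set
p ≈ q = ∀ B → (Block p B → Block q B) × (Block q B → Block p B)

-- p is coarser than or equal to q.
_⊑_ : Partition t → Partition t → Set
p ⊑ q = ∀ B → Block q B → ∃ λ C → Block p C × B ⊆ C

_≈?_ : (p q : Partition t) → Dec (p ≈ q)
p ≈? q = allSubset? λ B →
  (Block? p B →-dec Block? q B) ×-dec (Block? q B →-dec Block? p B)

_⊑?_ : (p q : Partition t) → Dec (p ⊑ q)
p ⊑? q = allSubset? λ B →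
  Block? q B →-dec anySubset? (λ C → Block? p C ×-dec (B ⊆? C))

⊑-antisym-block : {p q : Partition t} → p ⊑ q → q ⊑ p → ∀ {B} → Block q B → Block p B
⊑-antisym-block {p = p} {q} p⊑q q⊑p {B} b with p⊑q B b
... | C , c , B⊆C with q⊑p C c
...   | D , d , C⊆D with nonempty q b
...     | x , x∈B with disjoint q b d x∈B (C⊆D (B⊆C x∈B))
...       | refl = subst (Block p) (⊆-antisym C⊆D B⊆C) c

⊑-isPartialOrder : IsPartialOrder (_≈_ {t}) _⊑_
⊑-isPartialOrder = record
  { isPreorder = record
    { isEquivalence = record
      { refl  = λ B → (λ b → b) , (λ b → b)
      ; sym   = λ p≈q B → proj₂ (p≈q B) , proj₁ (p≈q B)
      ; trans = λ p≈q q≈r B → proj₁ (q≈r B) ∘ proj₁ (p≈q B) , proj₂ (p≈q B) ∘ proj₂ (q≈r B)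
      }
    ; reflexive = λ p≈q B b → B , proj₂ (p≈q B) b , (λ x∈B → x∈B)
    ; trans = λ p⊑q q⊑r B b →
        let (C , c , B⊆C) = q⊑r B b ; (D , d , C⊆D) = p⊑q C c
        in D , d , C⊆D ∘ B⊆C
    }
  ; antisym = λ {p} {q} p⊑q q⊑p B →
      ⊑-antisym-block {p = q} {p} q⊑p p⊑q , ⊑-antisym-block {p = p} {q} p⊑q q⊑p
  }

-- The partition {U}.
whole : Partition (suc n)
whole .isBlock B = ⌊ B ≟ₛ ⊤ ⌋
whole .nonempty {B} b with refl ← toWitness {a? = B ≟ₛ ⊤} b = zero , ∈⊤
whole .covers x = ⊤ , fromWitness {a? = ⊤ ≟ₛ ⊤} refl , ∈⊤
whole .disjoint {B} {C} b c _ _ =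
  trans (toWitness {a? = B ≟ₛ ⊤} b) (sym (toWitness {a? = C ≟ₛ ⊤} c))

whole-minimum : (p : Partition (suc n)) → whole ⊑ p
whole-minimum p B b = ⊤ , fromWitness {a? = ⊤ ≟ₛ ⊤} refl , ⊆⊤

------------------------------------------------------------------------
-- The meet of two partitions

Closed : Partition t → Subset t → Set
Closed p S = ∀ B → Block p B → Nonempty (B ∩ S) → B ⊆ S

Closed? : (p : Partition t) → ∀ S → Dec (Closed p S)
Closed? p S = allSubset? λ B → Block? p B →-dec nonempty? (B ∩ S) →-dec (B ⊆? S)

Closed-∁ : (p : Partition t) → ∀ {S} → Closed p S → Closed p (∁ S)
Closed-∁ p {S} cl B b (x , x∈B∩∁S) {y} y∈B with x∈p∩q⁻ B (∁ S) x∈B∩∁S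
... | x∈B , x∈∁S = x∉p⇒x∈∁p λ y∈S →
  x∈∁p⇒x∉p x∈∁S (cl B b (y , x∈p∩q⁺ (y∈B , y∈S)) x∈B)

Closed-block : (p s : Partition t) → s ⊑ p → ∀ {C} → Block s C → Closed p C
Closed-block p s s⊑p {C} c B b (x , x∈B∩C) with x∈p∩q⁻ B C x∈B∩C | s⊑p B b
... | x∈B , x∈C | D , d , B⊆D with disjoint s d c (B⊆D x∈B) x∈C
...   | refl = B⊆D

-- y lies in every set containing x that is a union of blocks of p and
-- also a union of blocks of q.
Linked : (p q : Partition t) → Fin t → Fin t → Set
Linked p q x y = ∀ S → Closed p S → Closed q S → x ∈ S → y ∈ S

Linked? : (p q : Partition t) → ∀ x y → Dec (Linked p q x y)
Linked? p q x y = allSubset? λ S →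
  Closed? p S →-dec Closed? q S →-dec (x ∈? S) →-dec (y ∈? S)

Linked-sym : (p q : Partition t) → ∀ {x y} → Linked p q x y → Linked p q y x
Linked-sym p q {x} {y} l S clp clq y∈S with x ∈? S
... | yes x∈S = x∈S
... | no  x∉S = contradiction y∈S
  (x∈∁p⇒x∉p (l (∁ S) (Closed-∁ p clp) (Closed-∁ q clq) (x∉p⇒x∈∁p x∉S)))

class : (p q : Partition t) → Fin t → Subset t
class p q x = Vec.tabulate λ y → ⌊ Linked? p q x y ⌋

∈-class⁺ : (p q : Partition t) → ∀ {x y} → Linked p q x y → y ∈ class p q x
∈-class⁺ p q {x} {y} l with Linked? p q x y in eq
... | yes _ = Vec.lookup⇒[]= y _ (trans (Vec.lookup∘tabulate _ y) (cong ⌊_⌋ eq))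
... | no ¬l = contradiction l ¬l

∈-class⁻ : (p q : Partition t) → ∀ {x y} → y ∈ class p q x → Linked p q x y
∈-class⁻ p q {x} {y} y∈ = toWitness {a? = Linked? p q x y}
  (subst T (trans (sym (Vec.[]=⇒lookup y∈)) (Vec.lookup∘tabulate _ y)) _)

class-⊆ : (p q : Partition t) → ∀ {x y z} → z ∈ class p q x → z ∈ class p q y →
          class p q x ⊆ class p q y
class-⊆ p q z∈x z∈y w∈x = ∈-class⁺ p q λ S clp clq y∈S →
  ∈-class⁻ p q w∈x S clp clq
    (Linked-sym p q (∈-class⁻ p q z∈x) S clp clq (∈-class⁻ p q z∈y S clp clq y∈S))

IsClass? : (p q : Partition t) → ∀ B → Dec (∃ λ x → B ≡ class p q x)
IsClass? p q B = any? λ x → B ≟ₛ class p q x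
  where open import Data.Fin.Properties using (any?)

infixl 7 _⊓_

-- The blocks are the minimal nonempty sets that are unions of blocks of p
-- as well as unions of blocks of q. That this is the finest partition
-- coarser than both p and q is ⊓-infimum below.
_⊓_ : Partition t → Partition t → Partition t
(p ⊓ q) .isBlock B = ⌊ IsClass? p q B ⌋
(p ⊓ q) .nonempty {B} b with x , refl ← toWitness {a? = IsClass? p q B} b =
  x , ∈-class⁺ p q λ _ _ _ x∈S → x∈S
(p ⊓ q) .covers x =
  class p q x , fromWitness {a? = IsClass? p q _} (x , refl) , ∈-class⁺ p q λ _ _ _ x∈S → x∈S
(p ⊓ q) .disjoint {B} {C} b c z∈B z∈C
  with x , refl ← toWitness {a? = IsClass? p q B} b
     | y , refl ← toWitness {a? = IsClass? p q C} c
  = ⊆-antisym (class-⊆ p q z∈B z∈C) (class-⊆ p q z∈C z∈B)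

⊓-infimum : Infimum (_⊑_ {t}) _⊓_
⊓-infimum p q = lower₁ , lower₂ , greatest
  where
  lower₁ : p ⊓ q ⊑ p
  lower₁ B b with x , x∈B ← nonempty p b =
    class p q x , fromWitness {a? = IsClass? p q _} (x , refl) , λ y∈B →
      ∈-class⁺ p q λ S clp _ x∈S → clp B b (x , x∈p∩q⁺ (x∈B , x∈S)) y∈B

  lower₂ : p ⊓ q ⊑ q
  lower₂ B b with x , x∈B ← nonempty q b =
    class p q x , fromWitness {a? = IsClass? p q _} (x , refl) , λ y∈B →
      ∈-class⁺ p q λ S _ clq x∈S → clq B b (x , x∈p∩q⁺ (x∈B , x∈S)) y∈B

  greatest : ∀ s → s ⊑ p → s ⊑ q → s ⊑ p ⊓ q
  greatest s s⊑p s⊑q B b with x , refl ← toWitness {a? = IsClass? p q B} b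
    with C , c , x∈C ← covers s x =
    C , c , λ y∈B → ∈-class⁻ p q y∈B C (Closed-block p s s⊑p c) (Closed-block q s s⊑q c) x∈C

------------------------------------------------------------------------
-- Cuts

-- The ground set is Fin (suc n), whose element zero plays the role of the
-- fixed element 1 of U. The conditions are irrelevant, so that a cut is
-- determined by its two sides.
record Cut (n : ℕ) : Set where
  constructor cut
  field
    V₁ V₂        : Subset (suc n)
    .union       : V₁ ∪ V₂ ≡ ⊤
    .empty-inter : V₁ ∩ V₂ ≡ ⊥
    .root        : zero ∈ V₁

open Cut using (V₁; V₂)

V₁∪V₂≡⊤ : (c : Cut n) → V₁ c ∪ V₂ c ≡ ⊤
V₁∪V₂≡⊤ (cut _ _ u _ _) = recompute (_ ≟ₛ _) u

V₁∩V₂≡⊥ : (c : Cut n) → V₁ c ∩ V₂ c ≡ ⊥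
V₁∩V₂≡⊥ (cut _ _ _ i _) = recompute (_ ≟ₛ _) i

zero∈V₁ : (c : Cut n) → zero ∈ V₁ c
zero∈V₁ (cut V₁ _ _ _ z) = recompute (zero ∈? V₁) z

IsSide? : (c : Cut n) → ∀ B → Dec (Nonempty B × (B ≡ V₁ c ⊎ B ≡ V₂ c))
IsSide? c B = nonempty? B ×-dec ((B ≟ₛ V₁ c) ⊎-dec (B ≟ₛ V₂ c))

-- The partition whose blocks are the nonempty sets among V₁ and V₂.
⟦_⟧ : Cut n → Partition (suc n)
⟦ c ⟧ .isBlock B = ⌊ IsSide? c B ⌋
⟦ c ⟧ .nonempty {B} b = proj₁ (toWitness {a? = IsSide? c B} b)
⟦ c ⟧ .covers x with x∈p∪q⁻ (V₁ c) (V₂ c)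
                       (subst (x ∈_) (sym (V₁∪V₂≡⊤ c)) ∈⊤)
... | inj₁ x∈V₁ = V₁ c , fromWitness {a? = IsSide? c _} ((x , x∈V₁) , inj₁ refl) , x∈V₁
... | inj₂ x∈V₂ = V₂ c , fromWitness {a? = IsSide? c _} ((x , x∈V₂) , inj₂ refl) , x∈V₂
⟦ c ⟧ .disjoint {B} {C} {x} b b′ x∈B x∈C
  with toWitness {a? = IsSide? c B} b | toWitness {a? = IsSide? c C} b′
... | _ , inj₁ refl | _ , inj₁ refl = refl
... | _ , inj₂ refl | _ , inj₂ refl = refl
... | _ , inj₁ refl | _ , inj₂ refl = contradiction
  (subst (x ∈_) (V₁∩V₂≡⊥ c) (x∈p∩q⁺ (x∈B , x∈C))) ∉⊥
... | _ , inj₂ refl | _ , inj₁ refl = contradiction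
  (subst (x ∈_) (V₁∩V₂≡⊥ c) (x∈p∩q⁺ (x∈C , x∈B))) ∉⊥

subsets : ∀ n → List (Subset n)
subsets zero    = Vec.[] ∷ []
subsets (suc n) = map (outside Vec.∷_) (subsets n) ++ map (inside Vec.∷_) (subsets n)

-- The cut whose first side is zero together with the elements of S.
cutOf : Subset n → Cut n
cutOf S = cut V (∁ V) (p∪∁p≡⊤ V) (∩-inverseʳ V) Vec.here
  where V = inside Vec.∷ S

-- cuts-complete and cuts-unique below: every cut is listed exactly once.
cuts : ∀ n → List (Cut n)
cuts n = map cutOf (subsets n)

subsets-complete : (S : Subset n) → S ∈ₗ subsets n
subsets-complete Vec.[]              = here refl
subsets-complete (outside Vec.∷ S) = ∈-++⁺ˡ (∈-map⁺ _ (subsets-complete S))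
subsets-complete (inside Vec.∷ S)  = ∈-++⁺ʳ _ (∈-map⁺ _ (subsets-complete S))

subsets-unique : ∀ n → Unique (subsets n)
subsets-unique zero    = All.[] AllPairs.∷ AllPairs.[]
subsets-unique (suc n) = Unique.++⁺
  (Unique.map⁺ (λ { refl → refl }) (subsets-unique n))
  (Unique.map⁺ (λ { refl → refl }) (subsets-unique n))
  λ (∈l , ∈r) → outside≢inside
    (trans (sym (proj₂ (proj₂ (∈-map⁻ _ ∈l)))) (proj₂ (proj₂ (∈-map⁻ _ ∈r))))
  where
  outside≢inside : ∀ {A B : Subset n} → ¬ (outside Vec.∷ A ≡ inside Vec.∷ B)
  outside≢inside ()

∁-determined : (A B : Subset n) → A ∪ B ≡ ⊤ → A ∩ B ≡ ⊥ → B ≡ ∁ A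
∁-determined Vec.[] Vec.[] _ _ = refl
∁-determined (true  Vec.∷ A) (false Vec.∷ B) u i =
  cong (false Vec.∷_) (∁-determined A B (cong Vec.tail u) (cong Vec.tail i))
∁-determined (false Vec.∷ A) (true  Vec.∷ B) u i =
  cong (true Vec.∷_) (∁-determined A B (cong Vec.tail u) (cong Vec.tail i))

cuts-complete : (c : Cut n) → c ∈ₗ cuts n
cuts-complete (cut (false Vec.∷ S) W u i z) with () ← recompute (zero ∈? (false Vec.∷ S)) z
cuts-complete (cut (true Vec.∷ S) W u i z)
  with refl ← ∁-determined (true Vec.∷ S) W (recompute (_ ≟ₛ _) u) (recompute (_ ≟ₛ _) i)
  = ∈-map⁺ cutOf (subsets-complete S)

cuts-unique : ∀ n → Unique (cuts n)
cuts-unique n = Unique.map⁺ (cong (λ c → Vec.tail (V₁ c))) (subsets-unique n)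

------------------------------------------------------------------------
-- Matrices over ℤ₂, realised as Parity

Matrix : Set → Set → Set
Matrix I J = I → J → Parity

private variable
  I J K : Set

infixl 8 _ᵀ
infixl 7 _·[_]_

_ᵀ : Matrix I J → Matrix J I
(A ᵀ) j i = A i j

sum : List Parity → Parity
sum = foldr _⊕_ 0ℙ

-- Matrix product; the list enumerates the inner index set.
_·[_]_ : Matrix I J → List J → Matrix J K → Matrix I K
(A ·[ js ] B) i k = sum (map (λ j → A i j ⊗ B j k) js)

indicator : {P : Set} → Dec P → Parity
indicator P? = if ⌊ P? ⌋ then 1ℙ else 0ℙ

𝓜 : Matrix (Partition (suc n)) (Partition (suc n))
𝓜 p q = indicator (p ⊓ q ≈? whole)

𝓒 : Matrix (Partition (suc n)) (Cut n)
𝓒 p c = indicator (⟦ c ⟧ ⊑? p)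

{-# OPTIONS --safe #-}

-- By the universal property of the meet, 𝓒 p c · 𝓒 q c = 𝓒 (p ⊓ q) c, so the
-- (p, q) entry of 𝓒𝓒ᵀ is the parity of the number of cuts below r = p ⊓ q.
-- If r = {U}, only the cut (U, ∅) is below r. Otherwise the complement D of
-- the block of r containing zero is a nonempty union of blocks of r, and taking
-- the symmetric difference of V₁ with D is a fixed-point-free involution on the
-- cuts below r; the number of these cuts is therefore even.

module Submission where

open import Data.Bool.Base using (true; false; _xor_)
open import Data.Bool.Properties using (xor-assoc; xor-same; xor-identityʳ)
open import Data.Fin.Base using (zero)
open import Data.Fin.Subset
open import Data.Fin.Subset.Properties
open import Data.List.Base using ([]; _∷_; _++_; map)
open import Data.List.Properties using (map-++; map-∘; map-cong)
open import Data.Nat.Base using (ℕ; zero; suc)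
open import Data.Parity.Base using (Parity; 0ℙ; 1ℙ) renaming (_+_ to _⊕_; _*_ to _⊗_)
open import Data.Parity.Properties using (+-assoc; +-comm; +-identityʳ; p+p≡0ℙ)
open import Data.Product.Base using (_,_; proj₁; proj₂)
open import Data.Sum.Base using (inj₁; inj₂)
open import Data.Vec.Base using ([]; _∷_; lookup; zipWith; here; tail)
open import Data.Vec.Properties using (lookup-zipWith; []=⇒lookup; lookup⇒[]=)
open import Function.Base using (_∘_; id)
open import Relation.Binary.PropositionalEquality.Core
open import Relation.Binary.PropositionalEquality.Properties using (module ≡-Reasoning)
open import Relation.Binary.Structures using (module IsPartialOrder)
open import Relation.Nullary using (Dec; yes; no; ¬_; contradiction)
open import Relation.Nullary.Decidable using (fromWitness)
open import Defs

open Partition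
open Cut using (V₁; V₂)
open ≡-Reasoning

private variable
  n t : ℕ
  P Q : Set

-- Indicators of decidable propositions

indicator-true : (P? : Dec P) → P → indicator P? ≡ 1ℙ
indicator-true (yes _) _ = refl
indicator-true (no ¬p) p = contradiction p ¬p

indicator-false : (P? : Dec P) → ¬ P → indicator P? ≡ 0ℙ
indicator-false (yes p) ¬p = contradiction p ¬p
indicator-false (no _)  _  = refl

indicator-cong : (P? : Dec P) (Q? : Dec Q) → (P → Q) → (Q → P) →
                 indicator P? ≡ indicator Q?
indicator-cong (yes p) Q? f _ = sym (indicator-true Q? (f p))
indicator-cong (no ¬p) Q? _ g = sym (indicator-false Q? (¬p ∘ g))

indicator-× : {R : Set} (P? : Dec P) (Q? : Dec Q) (R? : Dec R) →
              (P → Q → R) → (R → P) → (R → Q) →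
              indicator P? ⊗ indicator Q? ≡ indicator R?
indicator-× (yes p) (yes q) R? f _ _ = sym (indicator-true R? (f p q))
indicator-× (yes _) (no ¬q) R? _ _ h = sym (indicator-false R? (¬q ∘ h))
indicator-× (no ¬p) _       R? _ g _ = sym (indicator-false R? (¬p ∘ g))

-- Sums over all subsets, modulo 2

∑ : (Subset n → Parity) → Parity
∑ f = sum (map f (subsets _))

∑-cong : {f g : Subset n → Parity} → (∀ S → f S ≡ g S) → ∑ f ≡ ∑ g
∑-cong f≗g = cong sum (map-cong f≗g (subsets _))

sum-++ : ∀ xs ys → sum (xs ++ ys) ≡ sum xs ⊕ sum ys
sum-++ []       ys = refl
sum-++ (x ∷ xs) ys = trans (cong (x ⊕_) (sum-++ xs ys)) (sym (+-assoc x (sum xs) (sum ys)))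

∑-suc : (f : Subset (suc n) → Parity) →
        ∑ f ≡ ∑ (f ∘ (outside ∷_)) ⊕ ∑ (f ∘ (inside ∷_))
∑-suc {n} f = begin
  sum (map f (map (outside ∷_) xs ++ map (inside ∷_) xs))
    ≡⟨ cong sum (map-++ f (map (outside ∷_) xs) _) ⟩
  sum (map f (map (outside ∷_) xs) ++ map f (map (inside ∷_) xs))
    ≡⟨ sum-++ (map f (map (outside ∷_) xs)) _ ⟩
  sum (map f (map (outside ∷_) xs)) ⊕ sum (map f (map (inside ∷_) xs))
    ≡⟨ cong₂ (λ ys zs → sum ys ⊕ sum zs) (map-∘ xs) (map-∘ xs) ⟨
  ∑ (f ∘ (outside ∷_)) ⊕ ∑ (f ∘ (inside ∷_)) ∎
  where xs = subsets n

∑-zero : (f : Subset n → Parity) → (∀ S → f S ≡ 0ℙ) → ∑ f ≡ 0ℙ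
∑-zero {zero}  f f≗0 = trans (+-identityʳ _) (f≗0 [])
∑-zero {suc n} f f≗0 = trans (∑-suc f)
  (cong₂ _⊕_ (∑-zero _ (f≗0 ∘ (outside ∷_))) (∑-zero _ (f≗0 ∘ (inside ∷_))))

∑-supported-⊤ : (f : Subset n → Parity) → (∀ S → S ≢ ⊤ → f S ≡ 0ℙ) → ∑ f ≡ f ⊤
∑-supported-⊤ {zero}  f _   = +-identityʳ _
∑-supported-⊤ {suc n} f f≗0 = trans (∑-suc f)
  (cong₂ _⊕_ (∑-zero _ (λ S → f≗0 (outside ∷ S) λ ()))
             (∑-supported-⊤ _ (λ S S≢⊤ → f≗0 (inside ∷ S) λ { refl → S≢⊤ refl })))

-- Symmetric difference and translation of sums

infixl 6 _△_

_△_ : Subset n → Subset n → Subset n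
_△_ = zipWith _xor_

△-cancelʳ : (S D : Subset n) → (S △ D) △ D ≡ S
△-cancelʳ []      []      = refl
△-cancelʳ (x ∷ S) (d ∷ D) = cong₂ _∷_
  (trans (xor-assoc x d d) (trans (cong (x xor_) (xor-same d)) (xor-identityʳ x)))
  (△-cancelʳ S D)

-- Translation by `D` permutes the subsets. Inductively, an `outside` head of `D` keeps the two
-- halves of the sum in place, and an `inside` head swaps them.
∑-△ : (f : Subset n → Parity) (D : Subset n) → ∑ (λ S → f (S △ D)) ≡ ∑ f
∑-△ f []            = refl
∑-△ f (outside ∷ D) = begin
  ∑ (λ S → f (S △ (outside ∷ D)))
    ≡⟨ ∑-suc (λ S → f (S △ (outside ∷ D))) ⟩
  ∑ (λ S → f (outside ∷ S △ D)) ⊕ ∑ (λ S → f (inside ∷ S △ D))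
    ≡⟨ cong₂ _⊕_ (∑-△ (f ∘ (outside ∷_)) D) (∑-△ (f ∘ (inside ∷_)) D) ⟩
  ∑ (f ∘ (outside ∷_)) ⊕ ∑ (f ∘ (inside ∷_))
    ≡⟨ ∑-suc f ⟨
  ∑ f ∎
∑-△ f (inside ∷ D) = begin
  ∑ (λ S → f (S △ (inside ∷ D)))
    ≡⟨ ∑-suc (λ S → f (S △ (inside ∷ D))) ⟩
  ∑ (λ S → f (inside ∷ S △ D)) ⊕ ∑ (λ S → f (outside ∷ S △ D))
    ≡⟨ cong₂ _⊕_ (∑-△ (f ∘ (inside ∷_)) D) (∑-△ (f ∘ (outside ∷_)) D) ⟩
  ∑ (f ∘ (inside ∷_)) ⊕ ∑ (f ∘ (outside ∷_))
    ≡⟨ +-comm (∑ (f ∘ (inside ∷_))) _ ⟩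
  ∑ (f ∘ (outside ∷_)) ⊕ ∑ (f ∘ (inside ∷_))
    ≡⟨ ∑-suc f ⟨
  ∑ f ∎

-- Translation by a nonempty `D` has no fixed points, so equal terms cancel in pairs. The recursion
-- runs to the first element of `D`, where the translation exchanges the two halves of the sum.
∑-△-invariant : (f : Subset n → Parity) (D : Subset n) → D ≢ ⊥ →
                (∀ S → f (S △ D) ≡ f S) → ∑ f ≡ 0ℙ
∑-△-invariant f []            D≢⊥ _   = contradiction refl D≢⊥
∑-△-invariant f (outside ∷ D) D≢⊥ inv = trans (∑-suc f)
  (cong₂ _⊕_ (∑-△-invariant _ D D≢⊥′ (inv ∘ (outside ∷_)))
             (∑-△-invariant _ D D≢⊥′ (inv ∘ (inside ∷_))))
  where
  D≢⊥′ : D ≢ ⊥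
  D≢⊥′ = D≢⊥ ∘ cong (outside ∷_)
∑-△-invariant f (inside ∷ D)  _   inv = begin
  ∑ f
    ≡⟨ ∑-suc f ⟩
  ∑ (f ∘ (outside ∷_)) ⊕ ∑ (f ∘ (inside ∷_))
    -- As `inside xor inside` computes to `outside`, invariance turns the `inside` half into a
    -- translate of the `outside` half.
    ≡⟨ cong (∑ (f ∘ (outside ∷_)) ⊕_) (∑-cong (inv ∘ (inside ∷_))) ⟨
  ∑ (f ∘ (outside ∷_)) ⊕ ∑ (λ S → f (outside ∷ S △ D))
    ≡⟨ cong (∑ (f ∘ (outside ∷_)) ⊕_) (∑-△ (f ∘ (outside ∷_)) D) ⟩
  ∑ (f ∘ (outside ∷_)) ⊕ ∑ (f ∘ (outside ∷_))
    ≡⟨ p+p≡0ℙ (∑ (f ∘ (outside ∷_))) ⟩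
  0ℙ ∎

-- Complements and unions of blocks

∁≡⊥⇒≡⊤ : (S : Subset n) → ∁ S ≡ ⊥ → S ≡ ⊤
∁≡⊥⇒≡⊤ S eq = begin
  S       ≡⟨ ∪-identityʳ S ⟨
  S ∪ ⊥   ≡⟨ cong (S ∪_) eq ⟨
  S ∪ ∁ S ≡⟨ p∪∁p≡⊤ S ⟩
  ⊤       ∎

-- Closedness as constancy of the characteristic function on blocks, a form that `_xor_` visibly
-- preserves.
Closed⇒lookup-≡ : (p : Partition t) {S : Subset t} → Closed p S →
                  ∀ {B} → Block p B → ∀ {x y} → x ∈ B → y ∈ B → lookup S x ≡ lookup S y
Closed⇒lookup-≡ p {S} cl {B} b {x} {y} x∈B y∈B
  with lookup S x in eqx | lookup S y in eqy
... | true  | true  = refl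
... | false | false = refl
... | true  | false = trans
  (sym ([]=⇒lookup (cl B b (x , x∈p∩q⁺ (x∈B , lookup⇒[]= x S eqx)) y∈B))) eqy
... | false | true  = trans (sym eqx)
  ([]=⇒lookup (cl B b (y , x∈p∩q⁺ (y∈B , lookup⇒[]= y S eqy)) x∈B))

Closed-△ : (p : Partition t) {S D : Subset t} → Closed p S → Closed p D → Closed p (S △ D)
Closed-△ p {S} {D} clS clD B b (x , x∈B∩S△D) {y} y∈B with x∈p∩q⁻ B (S △ D) x∈B∩S△D
... | x∈B , x∈S△D = lookup⇒[]= y (S △ D) (begin
  lookup (S △ D) y          ≡⟨ lookup-zipWith _xor_ y S D ⟩
  lookup S y xor lookup D y ≡⟨ cong₂ _xor_ (Closed⇒lookup-≡ p clS b x∈B y∈B)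
                                           (Closed⇒lookup-≡ p clD b x∈B y∈B) ⟨
  lookup S x xor lookup D x ≡⟨ lookup-zipWith _xor_ x S D ⟨
  lookup (S △ D) x          ≡⟨ []=⇒lookup x∈S△D ⟩
  inside                    ∎)

Closed-△⁻ : (p : Partition t) {S D : Subset t} → Closed p (S △ D) → Closed p D → Closed p S
Closed-△⁻ p {S} {D} cl clD = subst (Closed p) (△-cancelʳ S D) (Closed-△ p cl clD)

-- Cuts below a partition

side₁ : (c : Cut n) → Block ⟦ c ⟧ (V₁ c)
side₁ c = fromWitness {a? = IsSide? c _} ((zero , zero∈V₁ c) , inj₁ refl)

⊑⇒Closed : (p : Partition (suc n)) (c : Cut n) → ⟦ c ⟧ ⊑ p → Closed p (V₁ c)
⊑⇒Closed p c c⊑p = Closed-block p ⟦ c ⟧ c⊑p (side₁ c)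

-- One point of a block decides its side: if the point is in `V₁ c`, closedness puts the whole block
-- there; otherwise the complement, which is closed too and equals `V₂ c`, contains the block. The
-- point also shows that this side is nonempty.
Closed⇒⊑ : (p : Partition (suc n)) (c : Cut n) → Closed p (V₁ c) → ⟦ c ⟧ ⊑ p
Closed⇒⊑ p c cl B b with nonempty p b
... | x , x∈B with x ∈? V₁ c
...   | yes x∈V₁ = V₁ c , side₁ c , cl B b (x , x∈p∩q⁺ (x∈B , x∈V₁))
...   | no  x∉V₁ = V₂ c , fromWitness {a? = IsSide? c _} ((x , B⊆V₂ x∈B) , inj₂ refl) , B⊆V₂
  where
  V₂≡∁V₁ : V₂ c ≡ ∁ (V₁ c)
  V₂≡∁V₁ = ∁-determined (V₁ c) (V₂ c) (V₁∪V₂≡⊤ c) (V₁∩V₂≡⊥ c)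

  B⊆V₂ : B ⊆ V₂ c
  B⊆V₂ = subst (B ⊆_) (sym V₂≡∁V₁)
    (Closed-∁ p cl B b (x , x∈p∩q⁺ (x∈B , x∉p⇒x∈∁p x∉V₁)))

𝓒-true : (p : Partition (suc n)) (c : Cut n) → ⟦ c ⟧ ⊑ p → 𝓒 p c ≡ 1ℙ
𝓒-true p c = indicator-true (⟦ c ⟧ ⊑? p)

𝓒-false : (p : Partition (suc n)) (c : Cut n) → ¬ ⟦ c ⟧ ⊑ p → 𝓒 p c ≡ 0ℙ
𝓒-false p c = indicator-false (⟦ c ⟧ ⊑? p)

𝓒-cong : (p : Partition (suc n)) (c d : Cut n) →
         (⟦ c ⟧ ⊑ p → ⟦ d ⟧ ⊑ p) → (⟦ d ⟧ ⊑ p → ⟦ c ⟧ ⊑ p) → 𝓒 p c ≡ 𝓒 p d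
𝓒-cong p c d = indicator-cong (⟦ c ⟧ ⊑? p) (⟦ d ⟧ ⊑? p)

𝓒-× : (p q r : Partition (suc n)) (c : Cut n) →
      (⟦ c ⟧ ⊑ p → ⟦ c ⟧ ⊑ q → ⟦ c ⟧ ⊑ r) →
      (⟦ c ⟧ ⊑ r → ⟦ c ⟧ ⊑ p) → (⟦ c ⟧ ⊑ r → ⟦ c ⟧ ⊑ q) →
      𝓒 p c ⊗ 𝓒 q c ≡ 𝓒 r c
𝓒-× p q r c = indicator-× (⟦ c ⟧ ⊑? p) (⟦ c ⟧ ⊑? q) (⟦ c ⟧ ⊑? r)

𝓒-⊓ : (p q : Partition (suc n)) (c : Cut n) → 𝓒 p c ⊗ 𝓒 q c ≡ 𝓒 (p ⊓ q) c
𝓒-⊓ p q c = 𝓒-× p q (p ⊓ q) c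
  (proj₂ (proj₂ (⊓-infimum p q)) ⟦ c ⟧)
  (λ c⊑p⊓q → ⊑-trans {⟦ c ⟧} {p ⊓ q} {p} c⊑p⊓q (proj₁ (⊓-infimum p q)))
  (λ c⊑p⊓q → ⊑-trans {⟦ c ⟧} {p ⊓ q} {q} c⊑p⊓q (proj₁ (proj₂ (⊓-infimum p q))))
  where open IsPartialOrder ⊑-isPartialOrder using () renaming (trans to ⊑-trans)

-- Parity of the number of cuts below a partition

⊤-block⇒≈whole : (r : Partition (suc n)) → Block r ⊤ → r ≈ whole
⊤-block⇒≈whole r b = antisym {r} {whole} (λ B _ → ⊤ , b , ⊆⊤) (whole-minimum r)
  where open IsPartialOrder ⊑-isPartialOrder using (antisym)

≈whole⇒Closed-⊤ : (r : Partition (suc n)) → r ≈ whole → ∀ {S} → zero ∈ S → Closed r S → S ≡ ⊤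
≈whole⇒Closed-⊤ r r≈whole zero∈S cl = ⊆-antisym ⊆⊤
  (cl ⊤ (proj₂ (r≈whole ⊤) (fromWitness {a? = ⊤ ≟ₛ ⊤} refl)) (zero , x∈p∩q⁺ (∈⊤ , zero∈S)))

∑𝓒-whole : (r : Partition (suc n)) → r ≈ whole → ∑ (λ S → 𝓒 r (cutOf S)) ≡ 1ℙ
∑𝓒-whole r r≈whole = trans
  (∑-supported-⊤ (λ S → 𝓒 r (cutOf S)) λ S S≢⊤ → 𝓒-false r (cutOf S) λ c⊑r →
    S≢⊤ (cong tail (≈whole⇒Closed-⊤ r r≈whole here (⊑⇒Closed r (cutOf S) c⊑r))))
  -- The index `⊤` stands for the cut with first side the whole ground set and empty second side.
  (𝓒-true r (cutOf ⊤) (Closed⇒⊑ r (cutOf ⊤) λ _ _ _ → ⊆⊤))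

-- The index `S` omits `zero`, which always lies in the first side. Translating `S` by `∁ K`
-- therefore translates the first side by `outside ∷ ∁ K`, the complement of the block of `zero`.
∑𝓒-block : (r : Partition (suc n)) (K : Subset n) → Block r (inside ∷ K) → K ≢ ⊤ →
           ∑ (λ S → 𝓒 r (cutOf S)) ≡ 0ℙ
∑𝓒-block r K b K≢⊤ =
  ∑-△-invariant (λ S → 𝓒 r (cutOf S)) (∁ K) (K≢⊤ ∘ ∁≡⊥⇒≡⊤ K) λ S →
    𝓒-cong r (cutOf (S △ ∁ K)) (cutOf S)
      (λ c⊑r → Closed⇒⊑ r (cutOf S)
        (Closed-△⁻ r (⊑⇒Closed r (cutOf (S △ ∁ K)) c⊑r) ∁-closed))
      (λ c⊑r → Closed⇒⊑ r (cutOf (S △ ∁ K))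
        (Closed-△ r (⊑⇒Closed r (cutOf S) c⊑r) ∁-closed))
  where
  ∁-closed : Closed r (outside ∷ ∁ K)
  ∁-closed = Closed-∁ r (Closed-block r r (λ B b′ → B , b′ , id) b)

∑𝓒-proper : (r : Partition (suc n)) → ¬ r ≈ whole → ∑ (λ S → 𝓒 r (cutOf S)) ≡ 0ℙ
∑𝓒-proper r r≉whole = let (B , b , zero∈B) = covers r zero in from-block b zero∈B
  where
  from-block : ∀ {B} → Block r B → zero ∈ B → ∑ (λ S → 𝓒 r (cutOf S)) ≡ 0ℙ
  -- Matching on `here` forces the head of the block to be `inside`.
  from-block {_ ∷ K} b here =
    ∑𝓒-block r K b λ K≡⊤ →
      r≉whole (⊤-block⇒≈whole r (subst (λ L → Block r (inside ∷ L)) K≡⊤ b))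

-- Taking the decision as an argument avoids normalising r ≈? whole.
∑𝓒 : (r : Partition (suc n)) (r≈whole? : Dec (r ≈ whole)) →
     ∑ (λ S → 𝓒 r (cutOf S)) ≡ indicator r≈whole?
∑𝓒 r (yes r≈whole) = ∑𝓒-whole r r≈whole
∑𝓒 r (no  r≉whole) = ∑𝓒-proper r r≉whole

lemma3p13 : ∀ (n : ℕ) (p q : Partition (suc n)) →
    𝓜 p q ≡ (𝓒 ·[ cuts n ] (𝓒 ᵀ)) p q
lemma3p13 n p q = begin
  𝓜 p q
    ≡⟨ ∑𝓒 (p ⊓ q) (p ⊓ q ≈? whole) ⟨
  ∑ (λ S → 𝓒 (p ⊓ q) (cutOf S))
    ≡⟨ ∑-cong (λ S → 𝓒-⊓ p q (cutOf S)) ⟨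
  ∑ (λ S → 𝓒 p (cutOf S) ⊗ 𝓒 q (cutOf S))
    -- `cuts n` is the image of `subsets n` under `cutOf`, so the sum over subsets is the sum over
    -- cuts.
    ≡⟨ cong sum (map-∘ (subsets n)) ⟩
  (𝓒 ·[ cuts n ] (𝓒 ᵀ)) p q ∎
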